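{- Let $(M,\leq_M)$ be a finite ordered monoid. If $M$ is a $T_q$ monoid for some $q>1$, or if $M$ is divided by one of $BA_2^+$, $U^+$, or a non-commutative finite group (with its equality order), then $N^1(M)=\Omega(n)$.
   Context: An ordered monoid is a monoid with a stable partial order ($x\leq y$ implies $zx\leq zy$ and $xz\leq yz$); an order ideal is a downward closed subset. $(N,\leq_N)$ divides $(M,\leq_M)$ if there is an order-preserving surjective monoid morphism from a submonoid of $M$ (with the restricted order) onto $N$. $M$ is a $T_q$ monoid if there exist idempotents $e,f\in M$ with $(ef)^qe=e$ but $(ef)^re\neq e$ whenever $q\nmid r$. Syntactic ordered monoid of $L\subseteq\Sigma^*$: $x\preceq_L y$ iff for all $u,v$, $uyv\in L\Rightarrow uxv\in L$; it is $\Sigma^*/\equiv_L$ ($x\equiv_L y$ iff $x\preceq_L y$ and $y\preceq_L x$) ordered by $[x]\leq[y]$ iff $x\preceq_L y$. $BA_2^+$ is the syntactic ordered monoid of $(ab)^*\subseteq\{a,b\}^*$; $U^+$ is the syntactic ordered monoid of the complement of $(a\cup b)^*aa(a\cup b)^*$ in $\{a,b\}^*$. For an order ideal $I$, the evaluation problem $(M,I)$ of length $n$: Alice receives $m_1,m_3,\dots,m_{2n-1}$, Bob receives $m_2,\dots,m_{2n}$, output $1$ iff $m_1\cdots m_{2n}\in I$. $N^1(M)$ is the maximum over $I$ of the non-deterministic communication complexity of $(M,I)$ as a function of $n$ (minimum over protocols with a common proof string $s$, accepting $1$-inputs for some $s$ and $0$-inputs for no $s$, of the maximum over $1$-inputs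 of the minimum over accepting $s$ of $|s|$ plus bits communicated). -}

module Defs where

open import Level using (0ℓ)
open import Data.Nat using (ℕ; zero; suc; _+_; _*_) renaming (_≤_ to _≤ℕ_)
open import Data.Nat.Divisibility using (_∣_)
open import Data.Bool using (Bool; true; false; if_then_else_)
open import Data.List using (List; []; _∷_; _++_; length)
open import Data.List.Membership.Propositional using (_∈_)
open import Data.Vec using (Vec; []; _∷_)
open import Data.Product using (Σ; ∃; ∃-syntax; _×_; _,_; proj₁; proj₂)
open import Data.Sum using (_⊎_)
open import Relation.Nullary using (¬_)
open import Relation.Binary using (Rel; IsPartialOrder)
open import Relation.Binary.PropositionalEquality using (_≡_)
import Algebra.Structures as AS
open import Function.Bundles using (_⇔_)

record OrderedMonoid : Set₁ where
  infixl 7 _∙_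
  infix 4 _≤_
  field
    Carrier        : Set
    _∙_            : Carrier → Carrier → Carrier
    ε              : Carrier
    _≤_            : Rel Carrier 0ℓ
    isMonoid       : AS.IsMonoid {A = Carrier} _≡_ _∙_ ε
    isPartialOrder : IsPartialOrder _≡_ _≤_
    compatˡ        : ∀ {x y} z → x ≤ y → z ∙ x ≤ z ∙ y
    compatʳ        : ∀ {x y} z → x ≤ y → x ∙ z ≤ y ∙ z

IsFinite : Set → Set
IsFinite A = Σ (List A) λ xs → ∀ x → x ∈ xs

record FiniteOrderedMonoid : Set₁ where
  field
    om     : OrderedMonoid
    finite : IsFinite (OrderedMonoid.Carrier om)
  open OrderedMonoid om public

record Divides (N M : OrderedMonoid) : Set₁ where
  module N = OrderedMonoid N
  module M = OrderedMonoid M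
  field
    Sub      : M.Carrier → Set
    sub-ε    : Sub M.ε
    sub-∙    : ∀ {x y} → Sub x → Sub y → Sub (x M.∙ y)
    φ        : (x : M.Carrier) → Sub x → N.Carrier
    φ-ε      : φ M.ε sub-ε ≡ N.ε
    φ-∙      : ∀ {x y} (p : Sub x) (q : Sub y) →
               φ (x M.∙ y) (sub-∙ p q) ≡ φ x p N.∙ φ y q
    φ-mono   : ∀ {x y} (p : Sub x) (q : Sub y) → x M.≤ y → φ x p N.≤ φ y q
    φ-surj   : ∀ z → Σ M.Carrier λ x → Σ (Sub x) λ p → φ x p ≡ z

module _ (M : OrderedMonoid) where
  open OrderedMonoid M

  pow : Carrier → ℕ → Carrier
  pow x zero    = ε
  pow x (suc r) = x ∙ pow x r

  IsIdempotent : Carrier → Set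
  IsIdempotent e = e ∙ e ≡ e

  IsTq : ℕ → Set
  IsTq q = Σ Carrier λ e → Σ Carrier λ f →
             IsIdempotent e × IsIdempotent f ×
             (pow (e ∙ f) q ∙ e ≡ e) ×
             (∀ r → ¬ (q ∣ r) → ¬ (pow (e ∙ f) r ∙ e ≡ e))

data AB : Set where
  a b : AB

Language : Set₁
Language = List AB → Set

SynLE : Language → List AB → List AB → Set
SynLE L x y = ∀ u v → L (u ++ y ++ v) → L (u ++ x ++ v)

-- N is (isomorphic to) the syntactic ordered monoid of L:
-- the quotient Σ*/≡_L ordered by ≼_L, presented via the canonical
-- surjective morphism η : Σ* → N reflecting and preserving the order.
record IsSyntacticOM (L : Language) (N : OrderedMonoid) : Set where
  open OrderedMonoid N
  field
    η      : List AB → Carrier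
    η-[]   : η [] ≡ ε
    η-++   : ∀ x y → η (x ++ y) ≡ η x ∙ η y
    η-surj : ∀ z → Σ (List AB) λ w → η w ≡ z
    η-ord  : ∀ x y → (η x ≤ η y) ⇔ SynLE L x y

data ABStar : Language where
  nil  : ABStar []
  cons : ∀ {w} → ABStar w → ABStar (a ∷ b ∷ w)

NoAA : Language
NoAA w = ¬ (Σ (List AB) λ u → Σ (List AB) λ v → w ≡ u ++ a ∷ a ∷ v)

DividedByBA2⁺ : OrderedMonoid → Set₁
DividedByBA2⁺ M = Σ OrderedMonoid λ N → IsSyntacticOM ABStar N × Divides N M

DividedByU⁺ : OrderedMonoid → Set₁
DividedByU⁺ M = Σ OrderedMonoid λ N → IsSyntacticOM NoAA N × Divides N M

record FiniteGroup : Set₁ where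
  infixl 7 _∙_
  field
    Carrier : Set
    _∙_     : Carrier → Carrier → Carrier
    ε       : Carrier
    _⁻¹     : Carrier → Carrier
    isGroup : AS.IsGroup {A = Carrier} _≡_ _∙_ ε _⁻¹
    finite  : IsFinite Carrier

groupOM : FiniteGroup → OrderedMonoid
groupOM G = record
  { Carrier        = Carrier
  ; _∙_            = _∙_
  ; ε              = ε
  ; _≤_            = _≡_
  ; isMonoid       = AS.IsGroup.isMonoid isGroup
  ; isPartialOrder = record
      { isPreorder = record
          { isEquivalence = Eq.isEquivalence
          ; reflexive     = λ p → p
          ; trans         = Eq.trans }
      ; antisym = λ p _ → p }
  ; compatˡ        = λ z p → Eq.cong (z ∙_) p
  ; compatʳ        = λ z p → Eq.cong (_∙ z) p
  }
  where
    open FiniteGroup G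
    import Relation.Binary.PropositionalEquality as Eq

IsNonCommutative : FiniteGroup → Set
IsNonCommutative G = Σ Carrier λ x → Σ Carrier λ y → ¬ (x ∙ y ≡ y ∙ x)
  where open FiniteGroup G

DividedByNonCommGroup : OrderedMonoid → Set₁
DividedByNonCommGroup M =
  Σ FiniteGroup λ G → IsNonCommutative G × Divides (groupOM G) M

data Protocol (A B : Set) : Set where
  leaf  : Bool → Protocol A B
  alice : (A → Bool) → Protocol A B → Protocol A B → Protocol A B
  bob   : (B → Bool) → Protocol A B → Protocol A B → Protocol A B

run : ∀ {A B} → Protocol A B → A → B → Bool × ℕ
run (leaf o)        x y = o , 0
run (alice f p₁ p₀) x y = step (f x) (run p₁ x y) (run p₀ x y)
  where
    step : Bool → Bool × ℕ → Bool × ℕ → Bool × ℕ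
    step true  (o , k) _ = o , suc k
    step false _ (o , k) = o , suc k
run (bob g p₁ p₀)   x y = step (g y) (run p₁ x y) (run p₀ x y)
  where
    step : Bool → Bool × ℕ → Bool × ℕ → Bool × ℕ
    step true  (o , k) _ = o , suc k
    step false _ (o , k) = o , suc k

-- non-deterministic protocol: a deterministic protocol for each proof string
NDProtocol : Set → Set → Set
NDProtocol A B = List Bool → Protocol A B

module _ (M : OrderedMonoid) where
  open OrderedMonoid M

  IsOrderIdeal : (Carrier → Set) → Set
  IsOrderIdeal I = ∀ {x y} → x ≤ y → I y → I x

  -- Alice holds m₁, m₃, …, m₂ₙ₋₁ ; Bob holds m₂, m₄, …, m₂ₙ
  -- value m₁ m₂ m₃ ⋯ m₂ₙ
  evalProd : ∀ {n} → Vec Carrier n → Vec Carrier n → Carrier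
  evalProd []       []       = ε
  evalProd (x ∷ xs) (y ∷ ys) = x ∙ (y ∙ evalProd xs ys)

  Solves : (I : Carrier → Set) (n : ℕ) → NDProtocol (Vec Carrier n) (Vec Carrier n) → Set
  Solves I n P = ∀ xs ys →
    (Σ (List Bool) λ s → proj₁ (run (P s) xs ys) ≡ true) ⇔ I (evalProd xs ys)

  CostAtMost : (I : Carrier → Set) (n : ℕ) → NDProtocol (Vec Carrier n) (Vec Carrier n) → ℕ → Set
  CostAtMost I n P c = ∀ xs ys → I (evalProd xs ys) →
    Σ (List Bool) λ s → (proj₁ (run (P s) xs ys) ≡ true) ×
                        (length s + proj₂ (run (P s) xs ys) ≤ℕ c)

  N¹-Ω-n : Set₁
  N¹-Ω-n = Σ ℕ λ k → Σ ℕ λ n₀ → ∀ n → n₀ ≤ℕ n →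
    Σ (Carrier → Set) λ I → IsOrderIdeal I ×
      (∀ P → Solves I n P → ∀ c → CostAtMost I n P c → n ≤ℕ k * c)

{-# OPTIONS --safe #-}
-- Everything reduces to unique disjointness.  A rectangle A × B of pairs of bit
-- vectors containing no pair that meets exactly once contains at most 2ⁿ of the
-- 3ⁿ disjoint pairs (Kaibel and Weltge): writing Aᵢ and Bᵢ for the sections of A and B
-- at the first bit, a disjoint pair of tails has at most as many disjoint
-- extensions in A × B as it has memberships in A₀ × (B₀ ∪ B₁) and (A₀ ∪ A₁) × B₀.
-- A non-deterministic protocol of cost c covers the disjoint pairs by at most 4ᶜ
-- rectangles, so c is linear in n.  In each of the four cases two letters of
-- each player compute x ∧ y, in such a way that a disjoint pair of vectors is sent into
-- an order ideal and a pair meeting exactly once is sent outside it.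
module Submission where

open import Defs
open import Data.Nat using (ℕ; zero; suc; _<_; _+_; _*_; _^_; _≤_; z≤n; s≤s; ⌊_/2⌋)
open import Data.Nat.Properties
open import Data.Nat.ListAction using (sum)
open import Data.Nat.Divisibility using (>⇒∤)
open import Data.Nat.Solver using (module +-*-Solver)
open import Data.Bool using (Bool; true; false; _∧_; _∨_; not; if_then_else_)
open import Data.Empty using (⊥-elim)
open import Data.List using (List; []; _∷_; _++_; length; map)
open import Data.List.Properties using (length-++; length-map; ++-identityʳ)
open import Data.List.Relation.Unary.All as All using (All; []; _∷_)
import Data.List.Relation.Unary.All.Properties as All
open import Data.List.Relation.Unary.Any as Any using (Any; here; there)
import Data.List.Relation.Unary.Any.Properties as Any
open import Data.Product using (Σ; _×_; _,_; proj₁; proj₂)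
open import Data.Sum using (_⊎_; inj₁; inj₂)
open import Data.Vec as Vec using (Vec; []; _∷_)
open import Data.Vec.Relation.Binary.Pointwise.Inductive using (Pointwise; []; _∷_)
open import Function using (_∘_)
open import Function.Bundles using (mk⇔; module Equivalence)
open import Relation.Nullary using (¬_)
open import Relation.Binary using (module IsPartialOrder)
open import Relation.Binary.PropositionalEquality
  using (_≡_; refl; sym; trans; cong; cong₂; subst; module ≡-Reasoning)
open import Algebra.Bundles using (Group)
import Algebra.Properties.Group as GroupProperties
import Algebra.Structures as AS

-- Pairs of bit vectors that are disjoint or meet once, and sums over the disjoint pairs.

data Apart : Bool → Bool → Set where
  ff : Apart false false
  ft : Apart false true
  tf : Apart true false

Disjoint : ∀ {n} → Vec Bool n → Vec Bool n → Set
Disjoint = Pointwise Apart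

data MeetOnce : ∀ {n} → Vec Bool n → Vec Bool n → Set where
  here  : ∀ {n} {x y : Vec Bool n} → Disjoint x y → MeetOnce (true ∷ x) (true ∷ y)
  there : ∀ {n p q} {x y : Vec Bool n} → Apart p q → MeetOnce x y → MeetOnce (p ∷ x) (q ∷ y)

-- The three choices of first bits are summed inside the sum over tails, so that the extensions of
-- one pair of tails can be bounded pointwise.
sumDisjoint : ∀ n → (Vec Bool n → Vec Bool n → ℕ) → ℕ
sumDisjoint zero    F = F [] []
sumDisjoint (suc n) F = sumDisjoint n λ x y →
  F (false ∷ x) (false ∷ y) + (F (false ∷ x) (true ∷ y) + F (true ∷ x) (false ∷ y))

sumDisjoint-mono : ∀ n {F G} → (∀ {x y} → Disjoint x y → F x y ≤ G x y) →
                   sumDisjoint n F ≤ sumDisjoint n G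
sumDisjoint-mono zero    F≤G = F≤G []
sumDisjoint-mono (suc n) F≤G = sumDisjoint-mono n λ d →
  +-mono-≤ (F≤G (ff ∷ d)) (+-mono-≤ (F≤G (ft ∷ d)) (F≤G (tf ∷ d)))

sumDisjoint-+ : ∀ n F G →
  sumDisjoint n (λ x y → F x y + G x y) ≤ sumDisjoint n F + sumDisjoint n G
sumDisjoint-+ zero    F G = ≤-refl
sumDisjoint-+ (suc n) F G = ≤-trans
  (sumDisjoint-mono n λ {x} {y} _ → ≤-reflexive
    (rearrange (F (false ∷ x) (false ∷ y)) _ (F (false ∷ x) (true ∷ y)) _ (F (true ∷ x) (false ∷ y)) _))
  (sumDisjoint-+ n _ _)
  where
  open +-*-Solver
  rearrange : ∀ a b c d e f → (a + b) + ((c + d) + (e + f)) ≡ (a + (c + e)) + (b + (d + f))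
  rearrange = solve 6 (λ a b c d e f →
    (a :+ b) :+ ((c :+ d) :+ (e :+ f)) := (a :+ (c :+ e)) :+ (b :+ (d :+ f))) refl

sumDisjoint-0 : ∀ n → sumDisjoint n (λ _ _ → 0) ≡ 0
sumDisjoint-0 zero    = refl
sumDisjoint-0 (suc n) = sumDisjoint-0 n

-- Stated for every `k` because peeling off a bit triples the constant summand.
3^n*k≤sumDisjoint : ∀ n k → 3 ^ n * k ≤ sumDisjoint n (λ _ _ → k)
3^n*k≤sumDisjoint zero    k = ≤-reflexive (+-identityʳ k)
3^n*k≤sumDisjoint (suc n) k = begin
  3 * 3 ^ n * k                       ≡⟨ cong (_* k) (*-comm 3 (3 ^ n)) ⟩
  3 ^ n * 3 * k                       ≡⟨ *-assoc (3 ^ n) 3 k ⟩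
  3 ^ n * (k + (k + (k + 0)))         ≡⟨ cong (λ l → 3 ^ n * (k + (k + l))) (+-identityʳ k) ⟩
  3 ^ n * (k + (k + k))               ≤⟨ 3^n*k≤sumDisjoint n _ ⟩
  sumDisjoint n (λ _ _ → k + (k + k)) ∎
  where open ≤-Reasoning

-- Rectangles that contain no pair meeting once.

Rectangle : Set → Set → Set
Rectangle A B = (A → Bool) × (B → Bool)

module _ {A B : Set} where

  contains : Rectangle A B → A → B → Bool
  contains (X , Y) x y = X x ∧ Y y

  indicator : Rectangle A B → A → B → ℕ
  indicator R x y = if contains R x y then 1 else 0

NoMeetOnce : ∀ {n} → Rectangle (Vec Bool n) (Vec Bool n) → Set
NoMeetOnce R = ∀ x y → MeetOnce x y → ¬ (contains R x y ≡ true)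

∧-true : ∀ {p q} → p ≡ true → q ≡ true → p ∧ q ≡ true
∧-true refl refl = refl

∧-true⁻¹ : ∀ p {q} → p ∧ q ≡ true → p ≡ true × q ≡ true
∧-true⁻¹ true q≡true = refl , q≡true

-- Here `pᵢ` and `qⱼ` record whether the one-bit extensions of two tails lie in the two sides of a
-- rectangle. Both sums agree unless `p₀` and `q₀` are true; then the right one is 2, and the left
-- one could exceed it only if `p₁` and `q₁` were both true.
extensions≤ : ∀ p₀ p₁ q₀ q₁ → ¬ (p₁ ∧ q₁ ≡ true) →
  (if p₀ ∧ q₀ then 1 else 0) + ((if p₀ ∧ q₁ then 1 else 0) + (if p₁ ∧ q₀ then 1 else 0))
  ≤ (if p₀ ∧ (q₀ ∨ q₁) then 1 else 0) + (if (p₀ ∨ p₁) ∧ q₀ then 1 else 0)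
extensions≤ false false q₀    q₁    _  = z≤n
extensions≤ false true  q₀    q₁    _  = ≤-refl
extensions≤ true  p₁    false false _  with p₁
... | false = z≤n
... | true  = z≤n
extensions≤ true  false false true  _  = ≤-refl
extensions≤ true  true  q₀    true  ¬t = ⊥-elim (¬t refl)
extensions≤ true  false true  false _  = s≤s z≤n
extensions≤ true  true  true  false _  = ≤-refl
extensions≤ true  false true  true  _  = ≤-refl

NoMeetOnce⇒sumDisjoint≤2^n : ∀ n R → NoMeetOnce R → sumDisjoint n (indicator R) ≤ 2 ^ n
NoMeetOnce⇒sumDisjoint≤2^n zero R _ with contains R [] []
... | false = z≤n
... | true  = ≤-refl
NoMeetOnce⇒sumDisjoint≤2^n (suc n) R@(X , Y) none = begin
  sumDisjoint (suc n) (indicator R)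
    -- Two ones in front of disjoint tails meet exactly once, so `none` rules out the fourth
    -- extension.
    ≤⟨ sumDisjoint-mono n (λ {x} {y} d →
         extensions≤ (X (false ∷ x)) (X (true ∷ x)) (Y (false ∷ y)) (Y (true ∷ y)) (none _ _ (here d))) ⟩
  sumDisjoint n (λ x y → indicator R₁ x y + indicator R₂ x y)
    ≤⟨ sumDisjoint-+ n _ _ ⟩
  sumDisjoint n (indicator R₁) + sumDisjoint n (indicator R₂)
    ≤⟨ +-mono-≤ (NoMeetOnce⇒sumDisjoint≤2^n n R₁ none₁) (NoMeetOnce⇒sumDisjoint≤2^n n R₂ none₂) ⟩
  2 ^ n + 2 ^ n
    ≡⟨ cong (2 ^ n +_) (sym (+-identityʳ (2 ^ n))) ⟩
  2 ^ suc n ∎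
  where
  open ≤-Reasoning
  R₁ R₂ : Rectangle (Vec Bool n) (Vec Bool n)
  R₁ = (λ x → X (false ∷ x)) , (λ y → Y (false ∷ y) ∨ Y (true ∷ y))
  R₂ = (λ x → X (false ∷ x) ∨ X (true ∷ x)) , (λ y → Y (false ∷ y))

  -- A pair of tails in `R₁` comes from an extension in `R` by apart first bits. These add no
  -- meeting, so a single meeting of the tails would be a single meeting in `R`.
  none₁ : NoMeetOnce R₁
  none₁ x y m c with X (false ∷ x) in eqX | Y (false ∷ y) in eqY | Y (true ∷ y) in eqY'
  ... | true | true | _    = none _ _ (there ff m) (∧-true eqX eqY)
  ... | true | false | true = none _ _ (there ft m) (∧-true eqX eqY')

  none₂ : NoMeetOnce R₂
  none₂ x y m c with X (false ∷ x) in eqX | X (true ∷ x) in eqX' | Y (false ∷ y) in eqY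
  ... | true  | _    | true = none _ _ (there ff m) (∧-true eqX eqY)
  ... | false | true | true = none _ _ (there tf m) (∧-true eqX' eqY)

totalIndicator : ∀ {A B : Set} → List (Rectangle A B) → A → B → ℕ
totalIndicator Rs x y = sum (map (λ R → indicator R x y) Rs)

Covers : ∀ {A B : Set} → List (Rectangle A B) → A → B → Set
Covers Rs x y = Any (λ R → contains R x y ≡ true) Rs

1≤totalIndicator : ∀ {A B : Set} {x : A} {y : B} {Rs} → Covers Rs x y → 1 ≤ totalIndicator Rs x y
1≤totalIndicator {Rs = R ∷ Rs} (here c) rewrite c = s≤s z≤n
1≤totalIndicator {x = x} {y} {R ∷ Rs} (there p) =
  ≤-trans (1≤totalIndicator p) (m≤n+m _ (indicator R x y))

sumDisjoint-totalIndicator : ∀ n {Rs} → All NoMeetOnce Rs →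
  sumDisjoint n (totalIndicator Rs) ≤ length Rs * 2 ^ n
sumDisjoint-totalIndicator n []               = ≤-reflexive (sumDisjoint-0 n)
sumDisjoint-totalIndicator n {R ∷ Rs} (none ∷ nones) = ≤-trans
  (sumDisjoint-+ n (indicator R) (totalIndicator Rs))
  (+-mono-≤ (NoMeetOnce⇒sumDisjoint≤2^n n R none) (sumDisjoint-totalIndicator n nones))

-- Double counting of incidences: each of the 3ⁿ disjoint pairs lies in at least one rectangle, and
-- each rectangle contains at most 2ⁿ of them.
3^n≤cover*2^n : ∀ n {Rs} → All NoMeetOnce Rs → (∀ {x y} → Disjoint x y → Covers Rs x y) →
                3 ^ n ≤ length Rs * 2 ^ n
3^n≤cover*2^n n {Rs} nones cover = begin
  3 ^ n                                ≡⟨ sym (*-identityʳ (3 ^ n)) ⟩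
  3 ^ n * 1                            ≤⟨ 3^n*k≤sumDisjoint n 1 ⟩
  sumDisjoint n (λ _ _ → 1)            ≤⟨ sumDisjoint-mono n (λ d → 1≤totalIndicator (cover d)) ⟩
  sumDisjoint n (totalIndicator Rs)    ≤⟨ sumDisjoint-totalIndicator n nones ⟩
  length Rs * 2 ^ n                    ∎
  where open ≤-Reasoning

-- Accepting rectangles of deterministic and non-deterministic protocols.

module _ {A B : Set} where

  restrictˡ : (A → Bool) → Rectangle A B → Rectangle A B
  restrictˡ f (X , Y) = (λ x → f x ∧ X x) , Y

  restrictʳ : (B → Bool) → Rectangle A B → Rectangle A B
  restrictʳ g (X , Y) = X , (λ y → g y ∧ Y y)

  contains-restrictˡ : ∀ f {x y} R → f x ≡ true → contains R x y ≡ true →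
                       contains (restrictˡ f R) x y ≡ true
  contains-restrictˡ f R fx c rewrite fx = c

  contains-restrictʳ : ∀ g {x y} R → g y ≡ true → contains R x y ≡ true →
                       contains (restrictʳ g R) x y ≡ true
  contains-restrictʳ g R gy c rewrite gy = c

  contains-restrictʳ⁻¹ : ∀ g {x y} R → contains (restrictʳ g R) x y ≡ true →
                         g y ≡ true × contains R x y ≡ true
  contains-restrictʳ⁻¹ g {x} {y} (X , Y) c with ∧-true⁻¹ (X x) c
  ... | Xx , gY with ∧-true⁻¹ (g y) gY
  ...   | gy , Yy = gy , ∧-true Xx Yy

  Accepts : Protocol A B → A → B → Set
  Accepts P x y = proj₁ (run P x y) ≡ true

  bits : Protocol A B → A → B → ℕ
  bits P x y = proj₂ (run P x y)

  -- One rectangle per accepting leaf. The tree may be deeper than the cost on the inputs of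
  -- interest, so `c` limits the depth explored and longer branches are cut; this is what makes the
  -- count at most 2ᶜ.
  acceptingRectangles : ℕ → Protocol A B → List (Rectangle A B)
  acceptingRectangles c       (leaf true)     = ((λ _ → true) , (λ _ → true)) ∷ []
  acceptingRectangles c       (leaf false)    = []
  acceptingRectangles zero    (alice f P₁ P₀) = []
  acceptingRectangles zero    (bob g P₁ P₀)   = []
  acceptingRectangles (suc c) (alice f P₁ P₀) =
    map (restrictˡ f) (acceptingRectangles c P₁) ++ map (restrictˡ (not ∘ f)) (acceptingRectangles c P₀)
  acceptingRectangles (suc c) (bob g P₁ P₀) =
    map (restrictʳ g) (acceptingRectangles c P₁) ++ map (restrictʳ (not ∘ g)) (acceptingRectangles c P₀)

  length-acceptingRectangles : ∀ c P → length (acceptingRectangles c P) ≤ 2 ^ c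
  length-acceptingRectangles c       (leaf true)     = m^n>0 2 c
  length-acceptingRectangles c       (leaf false)    = z≤n
  length-acceptingRectangles zero    (alice f P₁ P₀) = z≤n
  length-acceptingRectangles zero    (bob g P₁ P₀)   = z≤n
  length-acceptingRectangles (suc c) (alice f P₁ P₀)
    rewrite length-++ (map (restrictˡ f) (acceptingRectangles c P₁))
                      {map (restrictˡ (not ∘ f)) (acceptingRectangles c P₀)}
          | length-map (restrictˡ f) (acceptingRectangles c P₁)
          | length-map (restrictˡ (not ∘ f)) (acceptingRectangles c P₀)
          | +-identityʳ (2 ^ c)
    = +-mono-≤ (length-acceptingRectangles c P₁) (length-acceptingRectangles c P₀)
  length-acceptingRectangles (suc c) (bob g P₁ P₀)
    rewrite length-++ (map (restrictʳ g) (acceptingRectangles c P₁))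
                      {map (restrictʳ (not ∘ g)) (acceptingRectangles c P₀)}
          | length-map (restrictʳ g) (acceptingRectangles c P₁)
          | length-map (restrictʳ (not ∘ g)) (acceptingRectangles c P₀)
          | +-identityʳ (2 ^ c)
    = +-mono-≤ (length-acceptingRectangles c P₁) (length-acceptingRectangles c P₀)

  acceptingRectangles-cover : ∀ c P {x y} → Accepts P x y → bits P x y ≤ c →
                              Covers (acceptingRectangles c P) x y
  acceptingRectangles-cover c (leaf true) _ _ = here refl
  acceptingRectangles-cover c (alice f P₁ P₀) {x} {y} acc le with f x in eq
  acceptingRectangles-cover (suc c) (alice f P₁ P₀) acc (s≤s le) | true =
    Any.++⁺ˡ (Any.map⁺ (Any.map (λ {R} → contains-restrictˡ f R eq)
      (acceptingRectangles-cover c P₁ acc le)))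
  acceptingRectangles-cover (suc c) (alice f P₁ P₀) acc (s≤s le) | false =
    Any.++⁺ʳ _ (Any.map⁺ (Any.map (λ {R} → contains-restrictˡ (not ∘ f) R (cong not eq))
      (acceptingRectangles-cover c P₀ acc le)))
  acceptingRectangles-cover c (bob g P₁ P₀) {x} {y} acc le with g y in eq
  acceptingRectangles-cover (suc c) (bob g P₁ P₀) acc (s≤s le) | true =
    Any.++⁺ˡ (Any.map⁺ (Any.map (λ {R} → contains-restrictʳ g R eq)
      (acceptingRectangles-cover c P₁ acc le)))
  acceptingRectangles-cover (suc c) (bob g P₁ P₀) acc (s≤s le) | false =
    Any.++⁺ʳ _ (Any.map⁺ (Any.map (λ {R} → contains-restrictʳ (not ∘ g) R (cong not eq))
      (acceptingRectangles-cover c P₀ acc le)))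

  AllAccepted : Protocol A B → Rectangle A B → Set
  AllAccepted P R = ∀ x y → contains R x y ≡ true → Accepts P x y

  -- Cutting branches only loses rectangles, so soundness holds for every `c`, however deep the tree
  -- is.
  acceptingRectangles-accepted : ∀ c P → All (AllAccepted P) (acceptingRectangles c P)
  acceptingRectangles-accepted c       (leaf true)     = (λ _ _ _ → refl) ∷ []
  acceptingRectangles-accepted c       (leaf false)    = []
  acceptingRectangles-accepted zero    (alice f P₁ P₀) = []
  acceptingRectangles-accepted zero    (bob g P₁ P₀)   = []
  acceptingRectangles-accepted (suc c) (alice f P₁ P₀) = All.++⁺
    (All.map⁺ (All.map (λ {R} → first R) (acceptingRectangles-accepted c P₁)))
    (All.map⁺ (All.map (λ {R} → second R) (acceptingRectangles-accepted c P₀)))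
    where
    first : ∀ R → AllAccepted P₁ R → AllAccepted (alice f P₁ P₀) (restrictˡ f R)
    first R acc x y ct with f x
    ... | true = acc x y ct
    second : ∀ R → AllAccepted P₀ R → AllAccepted (alice f P₁ P₀) (restrictˡ (not ∘ f) R)
    second R acc x y ct with f x
    ... | false = acc x y ct
  acceptingRectangles-accepted (suc c) (bob g P₁ P₀) = All.++⁺
    (All.map⁺ (All.map (λ {R} → first R) (acceptingRectangles-accepted c P₁)))
    (All.map⁺ (All.map (λ {R} → second R) (acceptingRectangles-accepted c P₀)))
    where
    first : ∀ R → AllAccepted P₁ R → AllAccepted (bob g P₁ P₀) (restrictʳ g R)
    first R acc x y ct with contains-restrictʳ⁻¹ g {x} {y} R ct
    ... | gy , ct' rewrite gy = acc x y ct'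
    second : ∀ R → AllAccepted P₀ R → AllAccepted (bob g P₁ P₀) (restrictʳ (not ∘ g) R)
    second R acc x y ct with g y | contains-restrictʳ⁻¹ (not ∘ g) {x} {y} R ct
    ... | false | _ , ct' = acc x y ct'

  -- Proof bits and communicated bits draw on one budget, as in the cost: after a proof string of
  -- length l, depth c - l remains for the protocol.
  guessedRectangles : ℕ → NDProtocol A B → List (Rectangle A B)
  guessedRectangles zero    P = acceptingRectangles zero (P [])
  guessedRectangles (suc c) P = acceptingRectangles (suc c) (P []) ++
    (guessedRectangles c (P ∘ (true ∷_)) ++ guessedRectangles c (P ∘ (false ∷_)))

  -- The count f satisfies f(c + 1) ≤ 2 · 2ᶜ + 2 · f(c), and bounding 2ᶜ by 4ᶜ closes the induction.
  length-guessedRectangles : ∀ c P → length (guessedRectangles c P) ≤ 4 ^ c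
  length-guessedRectangles zero    P = length-acceptingRectangles zero (P [])
  length-guessedRectangles (suc c) P = begin
    length (guessedRectangles (suc c) P)
      ≡⟨ length-++ (acceptingRectangles (suc c) (P [])) ⟩
    length (acceptingRectangles (suc c) (P [])) + length (Gt ++ Gf)
      ≡⟨ cong (length (acceptingRectangles (suc c) (P [])) +_) (length-++ Gt) ⟩
    length (acceptingRectangles (suc c) (P [])) + (length Gt + length Gf)
      ≤⟨ +-mono-≤ (length-acceptingRectangles (suc c) (P []))
           (+-mono-≤ (length-guessedRectangles c _) (length-guessedRectangles c _)) ⟩
    2 * 2 ^ c + (4 ^ c + 4 ^ c)
      ≤⟨ +-monoˡ-≤ _ (*-monoʳ-≤ 2 (^-monoˡ-≤ c {2} {4} (s≤s (s≤s z≤n)))) ⟩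
    2 * 4 ^ c + (4 ^ c + 4 ^ c)
      ≡⟨ solve 1 (λ k → con 2 :* k :+ (k :+ k) := con 4 :* k) refl (4 ^ c) ⟩
    4 ^ suc c ∎
    where
    open ≤-Reasoning
    open +-*-Solver
    Gt = guessedRectangles c (P ∘ (true ∷_))
    Gf = guessedRectangles c (P ∘ (false ∷_))

  guessedRectangles-cover : ∀ c P s {x y} → Accepts (P s) x y → length s + bits (P s) x y ≤ c →
                            Covers (guessedRectangles c P) x y
  guessedRectangles-cover zero    P []          acc le = acceptingRectangles-cover zero (P []) acc le
  guessedRectangles-cover (suc c) P []          acc le =
    Any.++⁺ˡ (acceptingRectangles-cover (suc c) (P []) acc le)
  guessedRectangles-cover (suc c) P (true ∷ s)  acc (s≤s le) =
    Any.++⁺ʳ (acceptingRectangles (suc c) (P []))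
      (Any.++⁺ˡ (guessedRectangles-cover c (P ∘ (true ∷_)) s acc le))
  guessedRectangles-cover (suc c) P (false ∷ s) acc (s≤s le) =
    Any.++⁺ʳ (acceptingRectangles (suc c) (P []))
      (Any.++⁺ʳ (guessedRectangles c (P ∘ (true ∷_)))
        (guessedRectangles-cover c (P ∘ (false ∷_)) s acc le))

  guessedRectangles-accepted : ∀ c P →
    All (λ R → Σ (List Bool) λ s → AllAccepted (P s) R) (guessedRectangles c P)
  guessedRectangles-accepted zero    P = All.map (λ acc → [] , acc) (acceptingRectangles-accepted zero (P []))
  guessedRectangles-accepted (suc c) P = All.++⁺
    (All.map (λ acc → [] , acc) (acceptingRectangles-accepted (suc c) (P [])))
    (All.++⁺
      (All.map (λ (s , acc) → true ∷ s , acc) (guessedRectangles-accepted c (P ∘ (true ∷_))))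
      (All.map (λ (s , acc) → false ∷ s , acc) (guessedRectangles-accepted c (P ∘ (false ∷_)))))

-- The lower bound for unique disjointness.

-- Two factors at a time, from 8 ≤ 9. This makes the growth of (3/2)ⁿ explicit without logarithms.
2^[n+⌊n/2⌋]≤3^n : ∀ n → 2 ^ (n + ⌊ n /2⌋) ≤ 3 ^ n
2^[n+⌊n/2⌋]≤3^n zero          = ≤-refl
2^[n+⌊n/2⌋]≤3^n (suc zero)    = s≤s (s≤s z≤n)
2^[n+⌊n/2⌋]≤3^n (suc (suc n)) = begin
  2 * (2 * 2 ^ (n + suc ⌊ n /2⌋))   ≡⟨ cong (λ k → 2 * (2 * 2 ^ k)) (+-suc n ⌊ n /2⌋) ⟩
  2 * (2 * (2 * 2 ^ (n + ⌊ n /2⌋))) ≡⟨ solve 1 (λ k → con 2 :* (con 2 :* (con 2 :* k)) := con 8 :* k) refl (2 ^ (n + ⌊ n /2⌋)) ⟩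
  8 * 2 ^ (n + ⌊ n /2⌋)             ≤⟨ *-mono-≤ (n≤1+n 8) (2^[n+⌊n/2⌋]≤3^n n) ⟩
  9 * 3 ^ n                         ≡⟨ *-assoc 3 3 (3 ^ n) ⟩
  3 * (3 * 3 ^ n)                   ∎
  where
  open ≤-Reasoning
  open +-*-Solver

-- The protocol is left free on pairs that meet more than once, so a reduction only has to control
-- the other pairs. The 4ᶜ rectangles force 3ⁿ ≤ 4ᶜ · 2ⁿ, and the bound follows by comparing powers
-- of 2.
uniqueDisjointness : ∀ n (P : NDProtocol (Vec Bool n) (Vec Bool n)) c →
  (∀ {x y} → Disjoint x y → Σ (List Bool) λ s → Accepts (P s) x y × length s + bits (P s) x y ≤ c) →
  (∀ {x y} → MeetOnce x y → ∀ s → ¬ Accepts (P s) x y) →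
  ⌊ n /2⌋ ≤ 2 * c
uniqueDisjointness n P c complete sound = +-cancelˡ-≤ n _ _ (^-cancelʳ-≤ (begin
  2 ^ (n + ⌊ n /2⌋)                    ≤⟨ 2^[n+⌊n/2⌋]≤3^n n ⟩
  3 ^ n                                ≤⟨ 3^n≤cover*2^n n nones cover ⟩
  length (guessedRectangles c P) * 2 ^ n ≤⟨ *-monoˡ-≤ (2 ^ n) (length-guessedRectangles c P) ⟩
  4 ^ c * 2 ^ n                        ≡⟨ *-comm (4 ^ c) (2 ^ n) ⟩
  2 ^ n * (2 ^ 2) ^ c                  ≡⟨ cong (2 ^ n *_) (^-*-assoc 2 2 c) ⟩
  2 ^ n * 2 ^ (2 * c)                  ≡⟨ sym (^-distribˡ-+-* 2 n (2 * c)) ⟩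
  2 ^ (n + 2 * c)                      ∎))
  where
  open ≤-Reasoning
  ^-cancelʳ-≤ : ∀ {m k} → 2 ^ m ≤ 2 ^ k → m ≤ k
  ^-cancelʳ-≤ le = ≮⇒≥ λ k<m → <⇒≱ (^-monoʳ-< 2 (s≤s (s≤s z≤n)) k<m) le

  nones : All NoMeetOnce (guessedRectangles c P)
  nones = All.map (λ (s , acc) x y m ct → sound m s (acc x y ct)) (guessedRectangles-accepted c P)

  cover : ∀ {x y} → Disjoint x y → Covers (guessedRectangles c P) x y
  cover d with complete d
  ... | s , acc , le = guessedRectangles-cover c P s acc le

-- Reductions by local maps, and transfer along divisions.

module _ {A B A′ B′ : Set} (α : A′ → A) (β : B′ → B) where

  comap : Protocol A B → Protocol A′ B′
  comap (leaf o)        = leaf o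
  comap (alice f P₁ P₀) = alice (f ∘ α) (comap P₁) (comap P₀)
  comap (bob g P₁ P₀)   = bob (g ∘ β) (comap P₁) (comap P₀)

  run-comap : ∀ P x y → run (comap P) x y ≡ run P (α x) (β y)
  run-comap (leaf o)        x y = refl
  run-comap (alice f P₁ P₀) x y rewrite run-comap P₁ x y | run-comap P₀ x y with f (α x)
  ... | true  = refl
  ... | false = refl
  run-comap (bob g P₁ P₀) x y rewrite run-comap P₁ x y | run-comap P₀ x y with g (β y)
  ... | true  = refl
  ... | false = refl

-- Each player replaces every letter of `N` by a chosen preimage and runs the protocol for `M`. This
-- costs no communication, so the constants are unchanged.
N¹-Ω-n-Divides : ∀ {N M} → Divides N M → N¹-Ω-n N → N¹-Ω-n M
N¹-Ω-n-Divides {N} {M} D (k , n₀ , hard) = k , n₀ , λ n n₀≤n → transfer n (hard n n₀≤n)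
  where
  open Divides D
  module N≤ = IsPartialOrder N.isPartialOrder
  module M≤ = IsPartialOrder M.isPartialOrder

  lift : N.Carrier → M.Carrier
  lift z = proj₁ (φ-surj z)

  sub-lift : ∀ z → Sub (lift z)
  sub-lift z = proj₁ (proj₂ (φ-surj z))

  φ-lift : ∀ z → φ (lift z) (sub-lift z) ≡ z
  φ-lift z = proj₂ (proj₂ (φ-surj z))

  -- `φ` takes a membership proof as argument, so the proof assembled by `sub-∙` is returned along
  -- with the value that `φ-∙` computes on it.
  evalProd-lift : ∀ {n} (xs ys : Vec N.Carrier n) →
    Σ (Sub (evalProd M (Vec.map lift xs) (Vec.map lift ys))) λ p → φ _ p ≡ evalProd N xs ys
  evalProd-lift []       []       = sub-ε , φ-ε
  evalProd-lift (x ∷ xs) (y ∷ ys) with evalProd-lift xs ys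
  ... | p , φp = sub-∙ (sub-lift x) (sub-∙ (sub-lift y) p) ,
    trans (φ-∙ _ _) (cong₂ N._∙_ (φ-lift x)
      (trans (φ-∙ _ _) (cong₂ N._∙_ (φ-lift y) φp)))

  transfer : ∀ n →
    (Σ (N.Carrier → Set) λ I → IsOrderIdeal N I ×
      (∀ P → Solves N I n P → ∀ c → CostAtMost N I n P c → n ≤ k * c)) →
    Σ (M.Carrier → Set) λ I → IsOrderIdeal M I ×
      (∀ P → Solves M I n P → ∀ c → CostAtMost M I n P c → n ≤ k * c)
  transfer n (I , ideal , bound) = I↑ , I↑-ideal , λ P solves c cost →
    bound (λ s → comap (Vec.map lift) (Vec.map lift) (P s))
      (λ xs ys → mk⇔
        (λ (s , acc) → I↑⇒I xs ys (Equivalence.to (solves _ _)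
          (s , trans (sym (cong proj₁ (run-comap _ _ (P s) xs ys))) acc)))
        (λ i → let s , acc = Equivalence.from (solves _ _) (I⇒I↑ xs ys i) in
          s , trans (cong proj₁ (run-comap _ _ (P s) xs ys)) acc))
      c
      λ xs ys i → let s , acc , le = cost _ _ (I⇒I↑ xs ys i) in
        s , trans (cong proj₁ (run-comap _ _ (P s) xs ys)) acc ,
        subst (λ r → length s + proj₂ r ≤ c) (sym (run-comap _ _ (P s) xs ys)) le
    where
    -- The preimage of `I` lies in the submonoid and may fail to be downward closed in `M`, so its
    -- downward closure is taken. On products of lifted letters nothing is added, because `φ` is
    -- monotone and `I` is an ideal.
    I↑ : M.Carrier → Set
    I↑ m = Σ M.Carrier λ m′ → Σ (Sub m′) λ p → (m M.≤ m′) × I (φ m′ p)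

    I↑-ideal : IsOrderIdeal M I↑
    I↑-ideal x≤y (m′ , p , y≤m′ , i) = m′ , p , M≤.trans x≤y y≤m′ , i

    I⇒I↑ : ∀ xs ys → I (evalProd N xs ys) → I↑ (evalProd M (Vec.map lift xs) (Vec.map lift ys))
    I⇒I↑ xs ys i = let p , φp = evalProd-lift xs ys in _ , p , M≤.refl , subst I (sym φp) i

    I↑⇒I : ∀ xs ys → I↑ (evalProd M (Vec.map lift xs) (Vec.map lift ys)) → I (evalProd N xs ys)
    I↑⇒I xs ys (m′ , p′ , le , i) = let p , φp = evalProd-lift xs ys in
      subst I φp (ideal (φ-mono p p′ le) i)

-- Gadgets and the bound that they imply.

-- Two letters of each player encode one bit of each; Yes and No are invariants of the
-- suffix products of disjoint pairs and of pairs that meet once.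
record Gadget (M : OrderedMonoid) : Set₁ where
  open OrderedMonoid M using (Carrier; _∙_; ε)
  field
    a₁ b₁ a₂ b₂ : Bool → Carrier

  act : Bool → Bool → Carrier → Carrier
  act x y m = a₁ x ∙ (b₁ y ∙ (a₂ x ∙ (b₂ y ∙ m)))

  field
    Ideal Yes No : Carrier → Set
    isIdeal   : IsOrderIdeal M Ideal
    Yes⇒Ideal : ∀ {m} → Yes m → Ideal m
    No⇒¬Ideal : ∀ {m} → No m → ¬ Ideal m
    Yes-ε     : Yes ε
    Yes-act   : ∀ {x y m} → Apart x y → Yes m → Yes (act x y m)
    meet-act  : ∀ {m} → Yes m → No (act true true m)
    No-act    : ∀ {x y m} → Apart x y → No m → No (act x y m)

-- With q the value after both halvings, n < 4(q + 1) ≤ 8q once q ≥ 1; the factor 8 in place of 4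
-- absorbs the rounding.
n≤8*⌊⌊n/2⌋/2⌋ : ∀ n → 4 ≤ n → n ≤ 8 * ⌊ ⌊ n /2⌋ /2⌋
n≤8*⌊⌊n/2⌋/2⌋ (suc (suc (suc (suc n)))) (s≤s (s≤s (s≤s (s≤s z≤n)))) = step n
  where
  open ≤-Reasoning
  step : ∀ n → 4 + n ≤ 8 * suc ⌊ ⌊ n /2⌋ /2⌋
  step 0 = m≤m+n 4 4
  step 1 = m≤m+n 5 3
  step 2 = m≤m+n 6 2
  step 3 = m≤m+n 7 1
  step (suc (suc (suc (suc n)))) = begin
    4 + (4 + n)                          ≤⟨ +-mono-≤ (m≤m+n 4 4) (step n) ⟩
    8 + 8 * suc ⌊ ⌊ n /2⌋ /2⌋            ≡⟨ sym (*-suc 8 (suc ⌊ ⌊ n /2⌋ /2⌋)) ⟩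
    8 * suc (suc ⌊ ⌊ n /2⌋ /2⌋)          ∎

module _ {M : OrderedMonoid} (gadget : Gadget M) where
  open OrderedMonoid M using (Carrier; _∙_; ε; isMonoid)
  open Gadget gadget
  open AS.IsMonoid isMonoid using (identityˡ)

  encode : (Bool → Carrier) → (Bool → Carrier) → ∀ n → Vec Bool ⌊ n /2⌋ → Vec Carrier n
  encode l₁ l₂ zero          []       = []
  -- For odd `n` each player pads with one neutral letter.
  encode l₁ l₂ (suc zero)    []       = ε ∷ []
  encode l₁ l₂ (suc (suc n)) (x ∷ xs) = l₁ x ∷ l₂ x ∷ encode l₁ l₂ n xs

  value : ∀ n → Vec Bool ⌊ n /2⌋ → Vec Bool ⌊ n /2⌋ → Carrier
  value n x y = evalProd M (encode a₁ a₂ n x) (encode b₁ b₂ n y)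

  -- On a longer input `value` unfolds by computation to `act` applied to the value of the tail, so
  -- the invariants spread from the right end.
  Disjoint⇒Yes : ∀ n {x y} → Disjoint x y → Yes (value n x y)
  Disjoint⇒Yes zero          []       = Yes-ε
  Disjoint⇒Yes (suc zero)    []       = subst Yes (sym (trans (identityˡ _) (identityˡ _))) Yes-ε
  Disjoint⇒Yes (suc (suc n)) (p ∷ d) = Yes-act p (Disjoint⇒Yes n d)

  MeetOnce⇒No : ∀ n {x y} → MeetOnce x y → No (value n x y)
  MeetOnce⇒No (suc (suc n)) (here d)    = meet-act (Disjoint⇒Yes n d)
  MeetOnce⇒No (suc (suc n)) (there p m) = No-act p (MeetOnce⇒No n m)

  gadget⇒N¹-Ω-n : N¹-Ω-n M
  -- The constant 16 is 8 · 2: the 8 pays for two halvings, one for spending two letters per bit and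
  -- one inside `uniqueDisjointness`, and the 2 is the factor of `c` there.
  gadget⇒N¹-Ω-n = 16 , 4 , λ n 4≤n → Ideal , isIdeal , λ P solves c cost →
    let
      α = encode a₁ a₂ n
      β = encode b₁ b₂ n
      quarter≤ : ⌊ ⌊ n /2⌋ /2⌋ ≤ 2 * c
      quarter≤ = uniqueDisjointness ⌊ n /2⌋ (λ s → comap α β (P s)) c
        (λ {x} {y} d → let s , acc , le = cost (α x) (β y) (Yes⇒Ideal (Disjoint⇒Yes n d)) in
          s , trans (cong proj₁ (run-comap α β (P s) x y)) acc ,
          subst (λ r → length s + proj₂ r ≤ c) (sym (run-comap α β (P s) x y)) le)
        (λ {x} {y} m s acc → No⇒¬Ideal (MeetOnce⇒No n m) (Equivalence.to (solves (α x) (β y))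
          (s , trans (sym (cong proj₁ (run-comap α β (P s) x y))) acc)))
    in ≤-trans (n≤8*⌊⌊n/2⌋/2⌋ n 4≤n)
         (≤-trans (*-monoʳ-≤ 8 quarter≤) (≤-reflexive (sym (*-assoc 8 2 c))))

-- The gadget of a `T_q` monoid.

module _ (M : OrderedMonoid) where
  open OrderedMonoid M using (Carrier; _∙_; ε; isMonoid; isPartialOrder; compatˡ)
    renaming (_≤_ to _⊑_)
  open AS.IsMonoid isMonoid using (assoc; identityˡ; identityʳ)
  module ⊑ = IsPartialOrder isPartialOrder
  open ≡-Reasoning

  pow-+ : ∀ x m n → pow M x (m + n) ≡ pow M x m ∙ pow M x n
  pow-+ x zero    n = sym (identityˡ _)
  pow-+ x (suc m) n = trans (cong (x ∙_) (pow-+ x m n)) (sym (assoc _ _ _))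

  module _ {w e : Carrier} where

    pow-*-fixes : ∀ m k → pow M w m ∙ e ≡ e → pow M w (k * m) ∙ e ≡ e
    pow-*-fixes m zero    fix = identityˡ e
    pow-*-fixes m (suc k) fix = begin
      pow M w (m + k * m) ∙ e               ≡⟨ cong (_∙ e) (pow-+ w m (k * m)) ⟩
      pow M w m ∙ pow M w (k * m) ∙ e       ≡⟨ assoc _ _ _ ⟩
      pow M w m ∙ (pow M w (k * m) ∙ e)     ≡⟨ cong (pow M w m ∙_) (pow-*-fixes m k fix) ⟩
      pow M w m ∙ e                         ≡⟨ fix ⟩
      e                                     ∎

    pow-*-deflates : ∀ m k → pow M w m ∙ e ⊑ e → pow M w (k * m) ∙ e ⊑ e
    pow-*-deflates m zero    le = ⊑.reflexive (identityˡ e)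
    pow-*-deflates m (suc k) le = ⊑.trans
      (⊑.reflexive (trans (cong (_∙ e) (pow-+ w m (k * m))) (assoc _ _ _)))
      (⊑.trans (compatˡ (pow M w m) (pow-*-deflates m k le)) le)

    -- Write w for the base. Iterating the inequality gives wᵐ⁽q⁺¹⁾e ≤ wᵐe, and the left side is e
    -- because w to the power q + 1 fixes e. Antisymmetry concludes.
    deflates⇒fixes : ∀ q m → pow M w (suc q) ∙ e ≡ e → pow M w m ∙ e ⊑ e → pow M w m ∙ e ≡ e
    deflates⇒fixes q m fix le = ⊑.antisym le
      (⊑.trans
        (⊑.reflexive (trans (sym (pow-*-fixes (suc q) m fix))
          (trans (cong (λ k → pow M w k ∙ e) (*-comm m (suc q)))
            (trans (cong (_∙ e) (pow-+ w m (q * m))) (assoc _ _ _)))))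
        (compatˡ (pow M w m) (pow-*-deflates m q le)))

  -- A false bit contributes `f` and a true bit `ε`. Since `f` is idempotent, apart bits leave
  -- exactly one `f` between `e` and `z`; this completes a full period and the block acts as the
  -- identity behind `e`. Two true bits leave no `f`, and the product stops one factor short of the
  -- period, at `z`.
  Tq⇒gadget : ∀ q → 1 < q → IsTq M q → Gadget M
  Tq⇒gadget (suc zero)    (s≤s ()) _
  -- From here on the period is `suc (suc q)`, so the exponent `suc q` in `z` is one less than the
  -- period.
  Tq⇒gadget (suc (suc q)) _        (e , f , ee , ff′ , fix , moves) = record
    { a₁ = λ x → e ∙ toggle x
    ; b₁ = λ y → toggle y ∙ z
    ; a₂ = λ _ → ε
    ; b₂ = λ _ → ε
    ; Ideal = λ m → e ∙ m ⊑ e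
    ; Yes = λ m → e ∙ m ≡ e
    ; No = λ m → e ∙ m ≡ z
    ; isIdeal = λ x⊑y → ⊑.trans (compatˡ e x⊑y)
    ; Yes⇒Ideal = ⊑.reflexive
    -- If `z` were below `e`, the two would be equal, although the period does not divide `suc q`.
    ; No⇒¬Ideal = λ no le → moves (suc q) (>⇒∤ (n<1+n (suc q)))
        (deflates⇒fixes (suc q) (suc q) fix (subst (_⊑ e) no le))
    ; Yes-ε = identityʳ e
    ; Yes-act = λ ap yes → trans (e-act ap) yes
    ; meet-act = λ {m} yes → begin
        e ∙ ((e ∙ ε) ∙ ((ε ∙ z) ∙ (ε ∙ (ε ∙ m)))) ≡⟨ cong (e ∙_) (flatten ε ε m) ⟩
        e ∙ (e ∙ (ε ∙ (ε ∙ (z ∙ m))))             ≡⟨ cong (λ t → e ∙ (e ∙ t)) (trans (identityˡ _) (identityˡ _)) ⟩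
        e ∙ (e ∙ (z ∙ m))                         ≡⟨ absorb (z ∙ m) ⟩
        e ∙ (z ∙ m)                               ≡⟨ sym (assoc e z m) ⟩
        e ∙ z ∙ m                                 ≡⟨ cong (_∙ m) ez ⟩
        z ∙ m                                     ≡⟨ assoc _ e m ⟩
        pow M (e ∙ f) (suc q) ∙ (e ∙ m)           ≡⟨ cong (pow M (e ∙ f) (suc q) ∙_) yes ⟩
        z                                         ∎
    ; No-act = λ ap no → trans (e-act ap) no
    }
    where
    toggle : Bool → Carrier
    toggle true  = ε
    toggle false = f

    z : Carrier
    z = pow M (e ∙ f) (suc q) ∙ e

    absorb : ∀ m → e ∙ (e ∙ m) ≡ e ∙ m
    absorb m = trans (sym (assoc e e m)) (cong (_∙ m) ee)

    ez : e ∙ z ≡ z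
    ez = begin
      e ∙ (e ∙ f ∙ pow M (e ∙ f) q ∙ e)     ≡⟨ cong (e ∙_) (trans (cong (_∙ e) (assoc e f _)) (assoc e _ e)) ⟩
      e ∙ (e ∙ (f ∙ pow M (e ∙ f) q ∙ e))   ≡⟨ absorb _ ⟩
      e ∙ (f ∙ pow M (e ∙ f) q ∙ e)         ≡⟨ sym (trans (cong (_∙ e) (assoc e f _)) (assoc e _ e)) ⟩
      z                                     ∎

    flatten : ∀ s t m → (e ∙ s) ∙ ((t ∙ z) ∙ (ε ∙ (ε ∙ m))) ≡ e ∙ (s ∙ (t ∙ (z ∙ m)))
    flatten s t m = trans (cong (λ u → (e ∙ s) ∙ ((t ∙ z) ∙ u)) (trans (identityˡ _) (identityˡ m)))
      (trans (cong ((e ∙ s) ∙_) (assoc t z m)) (assoc e s _))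

    efz : ∀ m → e ∙ (f ∙ (z ∙ m)) ≡ e ∙ m
    efz m = begin
      e ∙ (f ∙ (z ∙ m))   ≡⟨ sym (assoc e f _) ⟩
      e ∙ f ∙ (z ∙ m)     ≡⟨ sym (assoc _ z m) ⟩
      e ∙ f ∙ z ∙ m       ≡⟨ cong (_∙ m) (trans (sym (assoc _ _ e)) fix) ⟩
      e ∙ m               ∎

    toggle-toggle : ∀ {x y} → Apart x y → ∀ m → toggle x ∙ (toggle y ∙ m) ≡ f ∙ m
    toggle-toggle ff m = trans (sym (assoc f f m)) (cong (_∙ m) ff′)
    toggle-toggle ft m = cong (f ∙_) (identityˡ m)
    toggle-toggle tf m = identityˡ _

    e-act : ∀ {x y m} → Apart x y →
      e ∙ ((e ∙ toggle x) ∙ ((toggle y ∙ z) ∙ (ε ∙ (ε ∙ m)))) ≡ e ∙ m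
    e-act {x} {y} {m} ap = begin
      e ∙ ((e ∙ toggle x) ∙ ((toggle y ∙ z) ∙ (ε ∙ (ε ∙ m)))) ≡⟨ cong (e ∙_) (flatten _ _ m) ⟩
      e ∙ (e ∙ (toggle x ∙ (toggle y ∙ (z ∙ m))))             ≡⟨ absorb _ ⟩
      e ∙ (toggle x ∙ (toggle y ∙ (z ∙ m)))                   ≡⟨ cong (e ∙_) (toggle-toggle ap _) ⟩
      e ∙ (f ∙ (z ∙ m))                                       ≡⟨ efz m ⟩
      e ∙ m                                                   ∎

-- Gadgets in syntactic ordered monoids.

record WordGadget (L : Language) : Set where
  field
    a₁ b₁ a₂ b₂ : Bool → List AB

  prepend : Bool → Bool → List AB → List AB
  prepend x y w = a₁ x ++ b₁ y ++ a₂ x ++ b₂ y ++ w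

  field
    L-[]       : L []
    L-prepend  : ∀ {x y w} → Apart x y → L w → L (prepend x y w)
    ¬L-prepend : ∀ {w} → ¬ L (prepend true true w)
    -- By contraposition, prepending a block of apart bits keeps words outside `L`.
    L-drop     : ∀ {x y w} → Apart x y → L (prepend x y w) → L w

-- The empty context in `SynLE` shows that `L` is downward closed for its syntactic preorder. Hence
-- its image is an order ideal, and the image of its complement is disjoint from it.
syntacticGadget : ∀ {L N} → IsSyntacticOM L N → WordGadget L → Gadget N
syntacticGadget {L} {N} syn G = record
  { a₁ = η ∘ a₁ ; b₁ = η ∘ b₁ ; a₂ = η ∘ a₂ ; b₂ = η ∘ b₂
  ; Ideal = Image L
  ; Yes = Image L
  ; No = Image (¬_ ∘ L)
  ; isIdeal = λ { {m} m⊑ (w , refl , Lw) → let v , ηv = η-surj m in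
      v , ηv , downward v w (subst (_⊑ η w) (sym ηv) m⊑) Lw }
  ; Yes⇒Ideal = λ i → i
  ; No⇒¬Ideal = λ { (v , ηv , ¬Lv) (w , ηw , Lw) →
      ¬Lv (downward v w (N⊑.reflexive (trans ηv (sym ηw))) Lw) }
  ; Yes-ε = [] , η-[] , L-[]
  ; Yes-act = λ { {x} {y} ap (w , refl , Lw) → prepend x y w , η-prepend x y w , L-prepend ap Lw }
  ; meet-act = λ { (w , refl , _) → prepend true true w , η-prepend true true w , ¬L-prepend }
  ; No-act = λ { {x} {y} ap (w , refl , ¬Lw) → prepend x y w , η-prepend x y w , ¬Lw ∘ L-drop ap }
  }
  where
  open IsSyntacticOM syn
  open OrderedMonoid N using (Carrier; _∙_; isPartialOrder) renaming (_≤_ to _⊑_)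
  module N⊑ = IsPartialOrder isPartialOrder
  open WordGadget G

  Image : Language → Carrier → Set
  Image K m = Σ (List AB) λ w → η w ≡ m × K w

  downward : ∀ v w → η v ⊑ η w → L w → L v
  downward v w v⊑w Lw = subst L (++-identityʳ v)
    (Equivalence.to (η-ord v w) v⊑w [] [] (subst L (sym (++-identityʳ w)) Lw))

  η-prepend : ∀ x y w → η (prepend x y w) ≡ η (a₁ x) ∙ (η (b₁ y) ∙ (η (a₂ x) ∙ (η (b₂ y) ∙ η w)))
  η-prepend x y w =
    trans (η-++ (a₁ x) _) (cong (η (a₁ x) ∙_)
      (trans (η-++ (b₁ y) _) (cong (η (b₁ y) ∙_)
        (trans (η-++ (a₂ x) _) (cong (η (a₂ x) ∙_) (η-++ (b₂ y) w))))))

-- Bob's ab is harmless at the start of a period but not between Alice's a and b.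
ABStar-wordGadget : WordGadget ABStar
ABStar-wordGadget = record
  { a₁ = λ x → if x then a ∷ [] else []
  ; b₁ = λ y → if y then a ∷ b ∷ [] else []
  ; a₂ = λ x → if x then b ∷ [] else []
  ; b₂ = λ _ → []
  ; L-[] = nil
  ; L-prepend = λ { ff l → l ; ft l → cons l ; tf l → cons l }
  ; ¬L-prepend = λ ()
  ; L-drop = λ { ff l → l ; ft (cons l) → l ; tf (cons l) → l }
  }

-- Each block has the form bxyb, where x and y are `a` for a true bit. The outer letters `b` prevent
-- `aa` from arising across blocks, so it appears only when both bits are true or within the rest of
-- the word.
NoAA-wordGadget : WordGadget NoAA
NoAA-wordGadget = record
  { a₁ = λ x → b ∷ letter x ∷ []
  ; b₁ = λ y → letter y ∷ b ∷ []
  ; a₂ = λ _ → []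
  ; b₂ = λ _ → []
  ; L-[] = λ { ([] , _ , ()) ; (_ ∷ _ , _ , ()) }
  ; L-prepend = λ { ff l → b∷ (b∷ (b∷ (b∷ l))) ; ft l → b∷ (b∷ (ab∷ l)) ; tf l → b∷ (ab∷ (b∷ l)) }
  ; ¬L-prepend = λ {w} l → l (b ∷ [] , b ∷ w , refl)
  ; L-drop = λ { _ l (u , v , refl) → l (_ ∷ _ ∷ _ ∷ _ ∷ u , v , refl) }
  }
  where
  letter : Bool → AB
  letter true  = a
  letter false = b

  b∷ : ∀ {w} → NoAA w → NoAA (b ∷ w)
  b∷ l (_ ∷ u , v , refl) = l (u , v , refl)

  ab∷ : ∀ {w} → NoAA w → NoAA (a ∷ b ∷ w)
  -- Matching `eq` with `refl` would have to unify `b ∷ w` with a stuck `++`, so a tail function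
  -- strips the first letter instead.
  ab∷ l (_ ∷ u , v , eq) = b∷ l (u , v , cong (λ { [] → [] ; (_ ∷ t) → t }) eq)

-- The gadget of a non-commutative group.

-- The block of the bits x and y evaluates to the commutator of gˣ and hʸ.
nonCommutativeGroup⇒gadget : ∀ G → IsNonCommutative G → Gadget (groupOM G)
nonCommutativeGroup⇒gadget G (g , h , gh≢hg) = record
  { a₁ = power g ; b₁ = power h ; a₂ = power (g ⁻¹) ; b₂ = power (h ⁻¹)
  ; Ideal = _≡ ε
  ; Yes = _≡ ε
  ; No = _≡ commutator
  ; isIdeal = trans
  ; Yes⇒Ideal = λ eq → eq
  ; No⇒¬Ideal = λ { refl eq → gh≢hg (commutes eq) }
  ; Yes-ε = refl
  ; Yes-act = λ ap eq → trans (act-id ap _) eq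
  ; meet-act = λ { refl → refl }
  ; No-act = λ ap eq → trans (act-id ap _) eq
  }
  where
  open FiniteGroup G
  open AS.IsGroup isGroup using (assoc; identityˡ; identityʳ; inverseʳ)
  group : Group _ _
  group = record { isGroup = isGroup }

  open GroupProperties group using (inverseˡ-unique; ⁻¹-anti-homo-∙; ⁻¹-involutive)
  open ≡-Reasoning

  power : Carrier → Bool → Carrier
  power x p = if p then x else ε

  commutator : Carrier
  commutator = g ∙ (h ∙ (g ⁻¹ ∙ (h ⁻¹ ∙ ε)))

  cancel : ∀ x m → x ∙ (x ⁻¹ ∙ m) ≡ m
  cancel x m = trans (sym (assoc x _ m)) (trans (cong (_∙ m) (inverseʳ x)) (identityˡ m))

  -- When one player's bit is false, that player's letters vanish and the other player's letter
  -- stands next to its inverse.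
  act-id : ∀ {x y} → Apart x y → ∀ m →
    power g x ∙ (power h y ∙ (power (g ⁻¹) x ∙ (power (h ⁻¹) y ∙ m))) ≡ m
  act-id ff m = trans (identityˡ _) (trans (identityˡ _) (trans (identityˡ _) (identityˡ m)))
  act-id ft m = trans (identityˡ _) (trans (cong (h ∙_) (identityˡ _)) (cancel h m))
  act-id tf m = trans (cong (g ∙_) (trans (identityˡ _) (cong (g ⁻¹ ∙_) (identityˡ m)))) (cancel g m)

  commutes : commutator ≡ ε → g ∙ h ≡ h ∙ g
  commutes eq = begin
    g ∙ h                     ≡⟨ inverseˡ-unique (g ∙ h) (g ⁻¹ ∙ h ⁻¹)
                                   (trans (assoc g h _)
                                     (trans (cong (λ t → g ∙ (h ∙ (g ⁻¹ ∙ t))) (sym (identityʳ _))) eq)) ⟩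
    (g ⁻¹ ∙ h ⁻¹) ⁻¹          ≡⟨ ⁻¹-anti-homo-∙ (g ⁻¹) (h ⁻¹) ⟩
    (h ⁻¹) ⁻¹ ∙ (g ⁻¹) ⁻¹     ≡⟨ cong₂ _∙_ (⁻¹-involutive h) (⁻¹-involutive g) ⟩
    h ∙ g                     ∎

theorem4p17 : (M : FiniteOrderedMonoid) →
    let om = FiniteOrderedMonoid.om M in
    (Σ ℕ (λ q → (1 < q) × IsTq om q)) ⊎ DividedByBA2⁺ om ⊎ DividedByU⁺ om ⊎ DividedByNonCommGroup om →
    N¹-Ω-n om
theorem4p17 M (inj₁ (q , 1<q , tq)) =
  gadget⇒N¹-Ω-n (Tq⇒gadget (FiniteOrderedMonoid.om M) q 1<q tq)
theorem4p17 M (inj₂ (inj₁ (N , syn , N∣M))) =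
  N¹-Ω-n-Divides N∣M (gadget⇒N¹-Ω-n (syntacticGadget syn ABStar-wordGadget))
theorem4p17 M (inj₂ (inj₂ (inj₁ (N , syn , N∣M)))) =
  N¹-Ω-n-Divides N∣M (gadget⇒N¹-Ω-n (syntacticGadget syn NoAA-wordGadget))
theorem4p17 M (inj₂ (inj₂ (inj₂ (G , nonComm , G∣M)))) =
  N¹-Ω-n-Divides G∣M (gadget⇒N¹-Ω-n (nonCommutativeGroup⇒gadget G nonComm))
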